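{- Fix $\mathcal{C}\in\{\mathsf{K},\mathsf{T},\mathsf{S4},\mathsf{S5}\}$, a modal formula $\varphi$ and a number $N$, and suppose the scan for $\varphi$ examines every frame in $\mathcal{C}$ of size $\le N$ together with every valuation. (1) If no countermodel is found and $N\ge b_{\mathcal{C}}(\varphi)$, then $\varphi$ is valid on $\mathcal{C}$. (2) If a countermodel is found, then the least $n\le N$ for which the scan finds a countermodel of size $n$ is the minimal size of a countermodel to $\varphi$ in $\mathcal{C}$, and it is witnessed by a valid certificate.
   Context: Modal formulas over variables $p_0,p_1,\dots$ are generated by $\varphi ::= \top\mid\bot\mid p_i\mid\neg\varphi\mid\varphi\wedge\varphi\mid\varphi\vee\varphi\mid\varphi\rightarrow\varphi\mid\Box\varphi\mid\Diamond\varphi$. A frame is $\mathcal{F}=(W,R)$ with $W$ finite and $R\subseteq W^2$; its size is $|W|$; a model adds a valuation $V$ assigning to each variable a subset of $W$. Satisfaction is standard Kripke satisfaction ($\Box$: all $R$-successors; $\Diamond$: some $R$-successor). $\mathcal{F}\models\varphi$ means $\varphi$ is true at every world under every valuation. A countermodel to $\varphi$ in $\mathcal{C}$ is $(\mathcal{F},V,w)$ with $\mathcal{F}\in\mathcal{C}$ and $\varphi$ false at $w$ in $(\mathcal{F},V)$; its size is the number of worlds. $\varphi$ is valid on $\mathcal{C}$ if $\mathcal{F}\models\varphi$ for all $\mathcal{F}\in\mathcal{C}$. Frame classes: $\mathsf{K}$ is all frames, $\mathsf{T}$ the reflexive frames, $\mathsf{S4}$ the preorders (reflexive and transitive), $\mathsf{S5}$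 the equivalence relations. Each class has the finite model property with a computable bound $b_{\mathcal{C}}(\varphi)$: if $\varphi$ is not valid on $\mathcal{C}$, it is refuted on some frame in $\mathcal{C}$ of size at most $b_{\mathcal{C}}(\varphi)$. Certificate: a tuple $c=(\varphi,n,\mathrm{succ},V,w,\mathcal{C})$ recording a formula, a world count $n$, a frame $\mathcal{F}$ on $\{0,\dots,n-1\}$ given by its successor masks $\mathrm{succ}[u]=\sum_{v:R(u,v)}2^v$, a valuation, a world and a class. It is valid if $\mathcal{F}\in\mathcal{C}$ and $\varphi$ is false at $w$ in $(\mathcal{F},V)$. Scan: frames of size $n$ are taken on $\{0,\dots,n-1\}$ and subsets $S$ are encoded as integers $\widehat S=\sum_{w\in S}2^w$. With $\mathit{full}=2^n-1$, $\overline{x}=\mathit{full}\mathbin{\&}(\sim x)$, and $\&,|,\sim$ bitwise AND, OR, NOT, the scan computes for each examined frame and valuation the integer $m(\varphi)$ defined by $m(\top)=\mathit{full}$, $m(\bot)=0$, $m(p_i)=\widehat{V(p_i)}$, $m(\neg\varphi)=\overline{m(\varphi)}$, $m(\varphi\wedge\psi)=m(\varphi)\mathbin{\&}m(\psi)$, $m(\varphi\vee\psi)=m(\varphi)\mathbin{|}m(\psi)$, $m(\varphi\rightarrow\psi)=\overline{m(\varphi)}\mathbin{|}m(\psi)$, bit $w$ of $m(\Box\varphi)$ equal to $1$ iff $\mathrm{succ}[w]\mathbin{\&}\overline{m(\varphi)}=0$, and bit $w$ of $m(\Diamond\varphi)$ equal to $1$ iff $\mathrm{succ}[w]\mathbin{\&}m(\varphi)\neq0$.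 It finds a countermodel of size $n$ at $(\mathcal{F},V)$ exactly when $m(\varphi)\neq\mathit{full}$, the falsifying worlds being the positions of the $0$ bits among bits $0,\dots,n-1$. -}

module Defs where

open import Algebra.Properties.Monoid.Sum as Sum using ()
open import Data.Bool.Base using (Bool; true; false; not; if_then_else_; _∧_; _∨_)
open import Data.Empty using (⊥)
open import Data.Fin.Base using (Fin; toℕ)
open import Data.Integer.Base as ℤ using (ℤ; +_; -[1+_]; 0ℤ)
open import Data.Integer.Properties as ℤ using ()
open import Data.Nat.Base using (ℕ; zero; suc; _+_; _∸_; _^_; _≤_; _≡ᵇ_)
open import Data.Nat.DivMod using (_/_; _%_)
open import Data.Nat.Properties using (+-0-monoid)
open import Data.Product.Base using (Σ-syntax; _×_)
open import Data.Sum.Base using (_⊎_)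
open import Data.Unit.Base using (⊤)
open import Function.Bundles using (_↔_)
open import Function.Construct.Identity using (↔-id)
open import Level using (0ℓ)
open import Relation.Binary.Core using (Rel)
open import Relation.Binary.Definitions using (Reflexive)
open import Relation.Binary.PropositionalEquality.Core using (_≡_; _≢_)
open import Relation.Binary.Structures using (IsPreorder; IsEquivalence)
open import Relation.Nullary.Decidable.Core using (does)
open import Relation.Nullary.Negation.Core using (¬_)

open Sum +-0-monoid using (sum)

infix  9 ¬′_ □_ ◇_
infixr 8 _∧′_
infixr 7 _∨′_
infixr 6 _⇒′_

data Formula : Set where
  ⊤′ ⊥′          : Formula
  var            : ℕ → Formula
  ¬′_            : Formula → Formula
  _∧′_ _∨′_ _⇒′_ : Formula → Formula → Formula
  □_ ◇_          : Formula → Formula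

-- Subsets of a finite set, such as R ⊆ W² and V(pᵢ) ⊆ W, are given by their
-- Bool-valued characteristic functions.  W need not be an initial segment
-- of ℕ, and the empty frame is allowed.

record Frame : Set₁ where
  field
    W    : Set
    size : ℕ
    enum : W ↔ Fin size
    R    : W → W → Bool

  _⟶_ : Rel W 0ℓ
  u ⟶ v = R u v ≡ true

Valuation : Set → Set
Valuation W = ℕ → W → Bool

-- The clauses are read constructively; this agrees with the classical
-- reading because satisfaction on a finite model is decidable.

module _ (F : Frame) where
  open Frame F

  Sat : Valuation W → W → Formula → Set
  Sat V w ⊤′       = ⊤
  Sat V w ⊥′       = ⊥
  Sat V w (var i)  = V i w ≡ true
  Sat V w (¬′ φ)   = ¬ Sat V w φ
  Sat V w (φ ∧′ ψ) = Sat V w φ × Sat V w ψ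
  Sat V w (φ ∨′ ψ) = Sat V w φ ⊎ Sat V w ψ
  Sat V w (φ ⇒′ ψ) = Sat V w φ → Sat V w ψ
  Sat V w (□ φ)    = ∀ v → w ⟶ v → Sat V v φ
  Sat V w (◇ φ)    = Σ[ v ∈ W ] (w ⟶ v) × Sat V v φ

infix 4 _⊨_ _∈ᶜ_

_⊨_ : Frame → Formula → Set
F ⊨ φ = ∀ (V : Valuation (Frame.W F)) w → Sat F V w φ

data FrameClass : Set where
  K T S4 S5 : FrameClass

_∈ᶜ_ : Frame → FrameClass → Set
F ∈ᶜ K  = ⊤
F ∈ᶜ T  = Reflexive (Frame._⟶_ F)
F ∈ᶜ S4 = IsPreorder _≡_ (Frame._⟶_ F)
F ∈ᶜ S5 = IsEquivalence (Frame._⟶_ F)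

ValidOn : FrameClass → Formula → Set₁
ValidOn 𝓒 φ = ∀ F → F ∈ᶜ 𝓒 → F ⊨ φ

record Countermodel (𝓒 : FrameClass) (φ : Formula) : Set₁ where
  field
    frame     : Frame
    inClass   : frame ∈ᶜ 𝓒
    valuation : Valuation (Frame.W frame)
    world     : Frame.W frame
    refutes   : ¬ Sat frame valuation world φ

  size : ℕ
  size = Frame.size frame

open Countermodel using (size)

IsMinimalCountermodelSize : FrameClass → Formula → ℕ → Set₁
IsMinimalCountermodelSize 𝓒 φ n =
  (Σ[ M ∈ Countermodel 𝓒 φ ] size M ≡ n) × (∀ (M : Countermodel 𝓒 φ) → n ≤ size M)

IsFMPBound : FrameClass → (Formula → ℕ) → Set₁
IsFMPBound 𝓒 b = ∀ φ → ¬ ValidOn 𝓒 φ → Σ[ M ∈ Countermodel 𝓒 φ ] size M ≤ b φ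

onFin : ∀ {n} → (Fin n → Fin n → Bool) → Frame
onFin {n} R = record { W = Fin n ; size = n ; enum = ↔-id (Fin n) ; R = R }

encode : ∀ {n} → (Fin n → Bool) → ℕ
encode S = sum (λ w → if S w then 2 ^ toℕ w else 0)

testBit : ℕ → ℕ → Bool
testBit x zero    = x % 2 ≡ᵇ 1
testBit x (suc i) = testBit (x / 2) i

-- Only used for f with f false false ≡ false; then a + b bits suffice, since
-- x < 2 ^ x.

bitwise : (Bool → Bool → Bool) → ℕ → ℕ → ℕ
bitwise f a b = encode {a + b} (λ i → f (testBit a (toℕ i)) (testBit b (toℕ i)))

andℕ orℕ andNotℕ : ℕ → ℕ → ℕ
andℕ    = bitwise _∧_
orℕ     = bitwise _∨_
andNotℕ = bitwise (λ x y → x ∧ not y)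

-- Bitwise operations on integers in (infinite) two's complement, where the
-- bits of -[1+ a ] are the negated bits of + a.

infix  9 ~_
infixr 7 _&_
infixr 6 _∥_

~_ : ℤ → ℤ
~ (+ a)    = -[1+ a ]
~ -[1+ a ] = + a

_&_ : ℤ → ℤ → ℤ
+ a      & + b      = + andℕ a b
+ a      & -[1+ b ] = + andNotℕ a b
-[1+ a ] & + b      = + andNotℕ b a
-[1+ a ] & -[1+ b ] = -[1+ orℕ a b ]

_∥_ : ℤ → ℤ → ℤ
+ a      ∥ + b      = + orℕ a b
+ a      ∥ -[1+ b ] = -[1+ andNotℕ b a ]
-[1+ a ] ∥ + b      = -[1+ andNotℕ a b ]
-[1+ a ] ∥ -[1+ b ] = -[1+ andℕ a b ]

full : ℕ → ℤ
full n = + (2 ^ n ∸ 1)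

complement : ℕ → ℤ → ℤ
complement n x = full n & ~ x

isZero : ℤ → Bool
isZero x = does (x ℤ.≟ 0ℤ)

succMask : ∀ {n} → (Fin n → Fin n → Bool) → Fin n → ℕ
succMask R u = encode (R u)

mask : ∀ {n} → (succ : Fin n → ℕ) (V̂ : ℕ → ℕ) → Formula → ℤ
mask {n} succ V̂ = m
  where
  m : Formula → ℤ
  m ⊤′       = full n
  m ⊥′       = 0ℤ
  m (var i)  = + V̂ i
  m (¬′ φ)   = complement n (m φ)
  m (φ ∧′ ψ) = m φ & m ψ
  m (φ ∨′ ψ) = m φ ∥ m ψ
  m (φ ⇒′ ψ) = complement n (m φ) ∥ m ψ
  m (□ φ)    = + encode (λ w → isZero (+ succ w & complement n (m φ)))
  m (◇ φ)    = + encode (λ w → not (isZero (+ succ w & m φ)))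

-- A scan of 𝓒 is represented by the set of pairs (frame, valuation) it
-- examines; that this set is exhaustive up to a given size is a separate
-- condition.

record Scan (𝓒 : FrameClass) : Set₁ where
  field
    Examined : ∀ {n} → (Fin n → Fin n → Bool) → Valuation (Fin n) → Set
    inClass  : ∀ {n} {R : Fin n → Fin n → Bool} {V : Valuation (Fin n)} →
               Examined R V → onFin R ∈ᶜ 𝓒

  ExaminesAllUpTo : ℕ → Set
  ExaminesAllUpTo N = ∀ {n} → n ≤ N → (R : Fin n → Fin n → Bool) → onFin R ∈ᶜ 𝓒 →
                      (V : Valuation (Fin n)) → Examined R V

  FindsCountermodelOfSize : Formula → ℕ → Set
  FindsCountermodelOfSize φ n =
    Σ[ R ∈ (Fin n → Fin n → Bool) ] Σ[ V ∈ Valuation (Fin n) ]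
      Examined R V × mask (succMask R) (λ i → encode (V i)) φ ≢ full n

record Certificate : Set where
  field
    formula   : Formula
    n         : ℕ
    succ      : Fin n → ℕ
    valuation : Valuation (Fin n)
    world     : Fin n
    class     : FrameClass

-- encode is injective, so the relation R is determined by succ.

ValidCertificate : Certificate → Set
ValidCertificate c =
  Σ[ R ∈ (Fin n → Fin n → Bool) ]
    (∀ u → succ u ≡ succMask R u) ×
    (onFin R ∈ᶜ class) ×
    ¬ Sat (onFin R) valuation world formula
  where open Certificate c

IsLeast : (ℕ → Set) → ℕ → Set
IsLeast P n = P n × (∀ k → P k → n ≤ k)

{-# OPTIONS --safe #-}

-- By induction on φ, m(φ) encodes the set of worlds satisfying φ, and encode
-- is injective, so m(φ) ≠ full exactly when φ fails somewhere.  A countermodel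
-- on any finite frame can be renumbered onto {0,…,n-1}, where the scan sees it.
-- The least n is found constructively because refutability at size n is
-- decidable: there are finitely many relations, and only the finitely many
-- variables below varBound φ matter in a valuation.

module Submission where

open import Defs
open import Algebra.Properties.Monoid.Sum using (sum-cong-≗)
open import Algebra.Properties.Semiring.Sum using (*-distribʳ-sum)
open import Data.Bool.Base using (Bool; true; false; not; if_then_else_; _∧_; _∨_)
open import Data.Bool.Properties as Bool using ()
open import Data.Fin.Base using (Fin; zero; suc; toℕ)
open import Data.Fin.Properties using (all?; any?; ¬∀⟶∃¬)
open import Data.Integer.Base as ℤ using (ℤ; +_; 0ℤ)
open import Data.Integer.Properties as ℤ using (+-injective)
open import Data.Nat.Base
  using (ℕ; zero; suc; _+_; _*_; _∸_; _^_; _≤_; _<_; _⊔_; z≤n; s≤s; s≤s⁻¹; _≡ᵇ_)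
open import Data.Nat.Divisibility.Core using (divides)
open import Data.Nat.DivMod
  using (_/_; _%_; [m+kn]%n≡m%n; m*n/n≡m; +-distrib-/-∣ʳ; m/n<m)
open import Data.Nat.Induction using (<-wellFounded; Acc; acc)
open import Data.Nat.Properties
  using ( +-0-monoid; +-*-semiring; *-comm; anyUpTo?; ≤-refl; ≤-trans; ≮⇒≥
        ; m≤m+n; m≤n+m; m<n⇒m<n⊔o; m<n⇒m<o⊔n )
open import Data.Product.Base using (Σ-syntax; ∃; ∃-syntax; _×_; _,_)
open import Data.Product.Function.NonDependent.Propositional using (_×-⇔_)
open import Data.Sum.Base using (inj₁; inj₂)
open import Data.Sum.Function.Propositional using (_⊎-⇔_)
open import Data.Unit.Base using (tt)
open import Data.Vec.Functional using (Vector; []; _∷_; head; tail)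
open import Function.Base using (_∘_; id)
open import Function.Bundles using (_⇔_; mk⇔; module Equivalence; module Inverse)
open import Function.Construct.Identity using (⇔-id)
open import Function.Related.TypeIsomorphisms using (→-cong-⇔; ¬-cong-⇔)
open import Level using (0ℓ)
open import Relation.Binary.Core using (Rel)
open import Relation.Binary.Definitions using (Reflexive; Symmetric; Transitive; _Respects_)
open import Relation.Binary.PropositionalEquality
  using (_≡_; _≢_; _≗_; refl; sym; trans; cong; cong₂; subst; isEquivalence; module ≡-Reasoning)
open import Relation.Binary.Structures using (IsPreorder; IsEquivalence)
open import Relation.Nullary.Decidable
  using ( Dec; yes; no; does; map; map′; ¬?; _×-dec_; _⊎-dec_; _→-dec_
        ; does-⇔; dec-true; dec-false; decidable-stable )
open import Relation.Nullary.Negation.Core using (¬_; contradiction)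
open import Relation.Unary using (Pred; Decidable)

-- Binary encodings of subsets

bit : Bool → ℕ
bit b = if b then 1 else 0

encode-cong : ∀ {n} {S S′ : Fin n → Bool} → S ≗ S′ → encode S ≡ encode S′
encode-cong S≗S′ =
  sum-cong-≗ +-0-monoid (λ w → cong (λ b → if b then 2 ^ toℕ w else 0) (S≗S′ w))

-- Horner form of the encoding. Since `testBit` recurses by halving, the lowest bit is split off in
-- the shape to which the division laws for `% 2` and `/ 2` apply.
encode-suc : ∀ {n} (S : Fin (suc n) → Bool) →
             encode S ≡ bit (S zero) + encode (S ∘ suc) * 2
encode-suc S = cong (_+_ (bit (S zero))) (trans
  (sum-cong-≗ +-0-monoid (λ w → double (S (suc w)) (2 ^ toℕ w)))
  (sym (*-distribʳ-sum +-*-semiring 2 (λ w → if S (suc w) then 2 ^ toℕ w else 0))))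
  where
  double : ∀ b m → (if b then 2 * m else 0) ≡ (if b then m else 0) * 2
  double false m = refl
  double true  m = *-comm 2 m

-- The successor on the left keeps the induction clear of the truncated subtraction in `full`. It
-- also makes the Horner form of the left side unfold to a multiple of 2.
encode-true : ∀ n → suc (encode {n} (λ _ → true)) ≡ 2 ^ n
encode-true zero    = refl
encode-true (suc n) = begin
  suc (encode {suc n} (λ _ → true))      ≡⟨ cong suc (encode-suc {n} (λ _ → true)) ⟩
  suc (encode {n} (λ _ → true)) * 2      ≡⟨ cong (_* 2) (encode-true n) ⟩
  2 ^ n * 2                              ≡⟨ *-comm (2 ^ n) 2 ⟩
  2 ^ suc n                              ∎
  where
  open ≡-Reasoning

encode-false : ∀ n → encode {n} (λ _ → false) ≡ 0
encode-false zero    = refl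
encode-false (suc n) = trans (encode-suc {n} (λ _ → false)) (cong (_* 2) (encode-false n))

encode-empty : ∀ {n} {S : Fin n → Bool} → (∀ w → S w ≡ false) → encode S ≡ 0
encode-empty {n} {S} S≗false = trans (encode-cong {S = S} S≗false) (encode-false n)

testBit-zero : ∀ b m → testBit (bit b + m * 2) 0 ≡ b
testBit-zero b m = trans (cong (_≡ᵇ 1) ([m+kn]%n≡m%n (bit b) m 2)) (lemma b)
  where
  lemma : ∀ b → (bit b % 2 ≡ᵇ 1) ≡ b
  lemma false = refl
  lemma true  = refl

bit+m*2/2≡m : ∀ b m → (bit b + m * 2) / 2 ≡ m
bit+m*2/2≡m false m = m*n/n≡m m 2
bit+m*2/2≡m true  m = trans (+-distrib-/-∣ʳ 1 (divides {2} m refl)) (m*n/n≡m m 2)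

testBit-encode-suc : ∀ {n} (S : Fin (suc n) → Bool) i →
                     testBit (encode S) (suc i) ≡ testBit (encode (S ∘ suc)) i
testBit-encode-suc S i = cong (λ x → testBit x i)
  (trans (cong (_/ 2) (encode-suc S)) (bit+m*2/2≡m (S zero) (encode (S ∘ suc))))

testBit-encode : ∀ {n} (S : Fin n → Bool) w → testBit (encode S) (toℕ w) ≡ S w
testBit-encode S zero    =
  trans (cong (λ x → testBit x 0) (encode-suc S)) (testBit-zero (S zero) (encode (S ∘ suc)))
testBit-encode S (suc w) =
  trans (testBit-encode-suc S (toℕ w)) (testBit-encode (S ∘ suc) w)

-- Halving a positive number strictly decreases it, so `x ≤ i` survives when the index drops by one.
-- This crude bound is what the width `a + b` in `bitwise` relies on.
testBit-≥ : ∀ {x i} → x ≤ i → testBit x i ≡ false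
testBit-≥ {zero}  {zero}  _   = refl
testBit-≥ {zero}  {suc i} _   = testBit-≥ {zero} {i} z≤n
testBit-≥ {suc x} {suc i} x≤i =
  testBit-≥ (s≤s⁻¹ (≤-trans (m/n<m (suc x) 2 (s≤s (s≤s z≤n))) x≤i))

testBit-encode-≥ : ∀ {n i} (S : Fin n → Bool) → n ≤ i → testBit (encode S) i ≡ false
testBit-encode-≥ {zero}  {i}     S _         = testBit-≥ {i = i} z≤n
testBit-encode-≥ {suc n} {suc i} S (s≤s n≤i) =
  trans (testBit-encode-suc S i) (testBit-encode-≥ (S ∘ suc) n≤i)

encode-injective : ∀ {n} {S S′ : Fin n → Bool} → encode S ≡ encode S′ → S ≗ S′
encode-injective {S = S} {S′} eq w = begin
  S w                          ≡⟨ testBit-encode S w ⟨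
  testBit (encode S) (toℕ w)   ≡⟨ cong (λ x → testBit x (toℕ w)) eq ⟩
  testBit (encode S′) (toℕ w)  ≡⟨ testBit-encode S′ w ⟩
  S′ w                         ∎
  where
  open ≡-Reasoning

-- `bitwise` writes `a + b` bits where a subset of `Fin n` has n, and either width may be the
-- larger. Recursion on both widths leaves a tail on which `g` vanishes, and such a tail encodes 0.
encode-resize : ∀ m n (g : ℕ → Bool) →
                (∀ i → m ≤ i → g i ≡ false) → (∀ i → n ≤ i → g i ≡ false) →
                encode {m} (g ∘ toℕ) ≡ encode {n} (g ∘ toℕ)
encode-resize zero    n       g m≤ _  =
  sym (encode-empty {n} (λ w → m≤ (toℕ w) z≤n))
encode-resize (suc m) zero    g _  n≤ =
  encode-empty {suc m} (λ w → n≤ (toℕ w) z≤n)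
encode-resize (suc m) (suc n) g m≤ n≤ = begin
  encode {suc m} (g ∘ toℕ)                        ≡⟨ encode-suc {m} (g ∘ toℕ) ⟩
  bit (g 0) + encode {m} (g ∘ suc ∘ toℕ) * 2      ≡⟨ cong (λ x → bit (g 0) + x * 2) ih ⟩
  bit (g 0) + encode {n} (g ∘ suc ∘ toℕ) * 2      ≡⟨ encode-suc {n} (g ∘ toℕ) ⟨
  encode {suc n} (g ∘ toℕ)                        ∎
  where
  open ≡-Reasoning
  ih = encode-resize m n (g ∘ suc)
         (λ i m≤i → m≤ (suc i) (s≤s m≤i)) (λ i n≤i → n≤ (suc i) (s≤s n≤i))

bitwise-encode : ∀ {n} (f : Bool → Bool → Bool) → f false false ≡ false →
                 (S S′ : Fin n → Bool) →
                 bitwise f (encode S) (encode S′) ≡ encode (λ w → f (S w) (S′ w))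
bitwise-encode {n} f ff≡f S S′ = trans
  (encode-resize (a + b) n g
    -- Beyond either width both operands have bit 0, where `f` returns `false`.
    (λ i a+b≤i → vanish (testBit-≥ (≤-trans (m≤m+n a b) a+b≤i))
                        (testBit-≥ (≤-trans (m≤n+m b a) a+b≤i)))
    (λ i n≤i → vanish (testBit-encode-≥ S n≤i) (testBit-encode-≥ S′ n≤i)))
  (encode-cong (λ w → cong₂ f (testBit-encode S w) (testBit-encode S′ w)))
  where
  a = encode S
  b = encode S′
  g : ℕ → Bool
  g i = f (testBit a i) (testBit b i)
  vanish : ∀ {x y} → x ≡ false → y ≡ false → f x y ≡ false
  vanish refl refl = ff≡f

full-encode : ∀ n → full n ≡ + encode {n} (λ _ → true)
full-encode n = cong (λ x → + (x ∸ 1)) (sym (encode-true n))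

complement-encode : ∀ {n} (S : Fin n → Bool) →
                    complement n (+ encode S) ≡ + encode (not ∘ S)
complement-encode {n} S = trans
  (cong (_& ~ (+ encode S)) (full-encode n))
  -- `~` makes the second argument negative, so `_&_` computes by its `andNotℕ` clause and the
  -- result is again a nonnegative encoding.
  (cong +_ (bitwise-encode (λ x y → x ∧ not y) refl (λ _ → true) S))

encode≡0⇔ : ∀ {n} (S : Fin n → Bool) → (+ encode S ≡ 0ℤ) ⇔ (∀ w → S w ≡ false)
encode≡0⇔ {n} S = mk⇔
  (λ eq → encode-injective (trans (+-injective eq) (sym (encode-false n))))
  (λ S≗false → cong +_ (encode-empty {S = S} S≗false))

-- Satisfaction on finite frames

_≟true : ∀ b → Dec (b ≡ true)
b ≟true = b Bool.≟ true

does-≟true : ∀ b → does (b ≟true) ≡ b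
does-≟true false = refl
does-≟true true  = refl

module _ {n} (R : Fin n → Fin n → Bool) (V : Valuation (Fin n)) where

  sat? : ∀ φ w → Dec (Sat (onFin R) V w φ)
  sat? ⊤′       w = yes tt
  sat? ⊥′       w = no λ ()
  sat? (var i)  w = V i w ≟true
  sat? (¬′ φ)   w = ¬? (sat? φ w)
  sat? (φ ∧′ ψ) w = sat? φ w ×-dec sat? ψ w
  sat? (φ ∨′ ψ) w = sat? φ w ⊎-dec sat? ψ w
  sat? (φ ⇒′ ψ) w = sat? φ w →-dec sat? ψ w
  sat? (□ φ)    w = all? (λ v → R w v ≟true →-dec sat? φ v)
  sat? (◇ φ)    w = any? (λ v → R w v ≟true ×-dec sat? φ v)

  truth : Formula → Fin n → Bool
  truth φ w = does (sat? φ w)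

  private
    m : Formula → ℤ
    m = mask (succMask R) (λ i → encode (V i))

  -- The integer encodes the set of successors refuting φ, and only the empty set is encoded by 0.
  □-mask⇔ : ∀ φ w → (+ encode (λ v → R w v ∧ not (truth φ v)) ≡ 0ℤ) ⇔ Sat (onFin R) V w (□ φ)
  □-mask⇔ φ w = mk⇔
    (λ eq v → to′ v (Equivalence.to (encode≡0⇔ _) eq v))
    (λ sat → Equivalence.from (encode≡0⇔ _) (λ v → from′ v (sat v)))
    where
    to′ : ∀ v → R w v ∧ not (truth φ v) ≡ false → R w v ≡ true → Sat (onFin R) V v φ
    -- If φ failed at `v`, `eq` would become `true ≡ false`.
    to′ v eq Rwv rewrite Rwv with sat? φ v
    ... | yes sat = sat
    from′ : ∀ v → (R w v ≡ true → Sat (onFin R) V v φ) → R w v ∧ not (truth φ v) ≡ false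
    from′ v sat with R w v
    ... | false = refl
    ... | true  = cong not (dec-true (sat? φ v) (sat refl))

  ◇-mask⇔ : ∀ φ w → (¬ + encode (λ v → R w v ∧ truth φ v) ≡ 0ℤ) ⇔ Sat (onFin R) V w (◇ φ)
  ◇-mask⇔ φ w = mk⇔
    -- Being nonzero only says that the set is not empty; decidability of `◇ φ` on a finite frame
    -- turns this into an actual successor.
    (λ ≢0 → decidable-stable (sat? (◇ φ) w)
       (λ ¬sat → ≢0 (Equivalence.from (encode≡0⇔ _) (λ v → unsat v (λ p q → ¬sat (v , p , q))))))
    (λ (v , Rwv , sat) ≡0 → contradiction
       (trans (sym (cong₂ _∧_ Rwv (dec-true (sat? φ v) sat))) (Equivalence.to (encode≡0⇔ _) ≡0 v))
       λ ())
    where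
    unsat : ∀ v → (R w v ≡ true → ¬ Sat (onFin R) V v φ) → R w v ∧ truth φ v ≡ false
    unsat v ¬sat with R w v
    ... | false = refl
    ... | true  = dec-false (sat? φ v) (¬sat refl)

  -- Proved jointly with `complement-mask`, which the clauses for `¬′`, `⇒′` and `□` call on a
  -- subformula. `does` computes through the propositional connectives, so only atoms and modalities
  -- need a separate link between bits and satisfaction.
  mask-encode : ∀ φ → m φ ≡ + encode (truth φ)
  complement-mask : ∀ φ → complement n (m φ) ≡ + encode (not ∘ truth φ)

  complement-mask φ =
    trans (cong (complement n) (mask-encode φ)) (complement-encode (truth φ))

  mask-encode ⊤′       = full-encode n
  mask-encode ⊥′       = cong +_ (sym (encode-false n))
  mask-encode (var i)  = cong +_ (encode-cong (λ w → sym (does-≟true (V i w))))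
  mask-encode (¬′ φ)   = complement-mask φ
  mask-encode (φ ∧′ ψ) = trans
    (cong₂ _&_ (mask-encode φ) (mask-encode ψ))
    (cong +_ (bitwise-encode _∧_ refl (truth φ) (truth ψ)))
  mask-encode (φ ∨′ ψ) = trans
    (cong₂ _∥_ (mask-encode φ) (mask-encode ψ))
    (cong +_ (bitwise-encode _∨_ refl (truth φ) (truth ψ)))
  mask-encode (φ ⇒′ ψ) = trans
    (cong₂ _∥_ (complement-mask φ) (mask-encode ψ))
    (cong +_ (bitwise-encode _∨_ refl (not ∘ truth φ) (truth ψ)))
  mask-encode (□ φ)    = cong +_ (encode-cong λ w → trans
    (cong isZero (trans
      (cong (+ succMask R w &_) (complement-mask φ))
      (cong +_ (bitwise-encode _∧_ refl (R w) (not ∘ truth φ)))))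
    -- Equivalent decidable propositions have equal decision bits; this identifies the zero test
    -- with `truth`.
    (does-⇔ (□-mask⇔ φ w) (_ ℤ.≟ 0ℤ) (sat? (□ φ) w)))
  mask-encode (◇ φ)    = cong +_ (encode-cong λ w → trans
    (cong (not ∘ isZero) (trans
      (cong (+ succMask R w &_) (mask-encode φ))
      (cong +_ (bitwise-encode _∧_ refl (R w) (truth φ)))))
    (does-⇔ (◇-mask⇔ φ w) (¬? (_ ℤ.≟ 0ℤ)) (sat? (◇ φ) w)))

  -- Satisfaction is decidable and the worlds are finitely many, so an unequal mask yields a
  -- concrete falsifying world. Conversely, injectivity of `encode` would make `truth φ` true
  -- everywhere.
  mask≢full⇔ : ∀ φ → m φ ≢ full n ⇔ (∃[ w ] ¬ Sat (onFin R) V w φ)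
  mask≢full⇔ φ = mk⇔
    (λ m≢full → ¬∀⟶∃¬ n _ (sat? φ) λ sat → m≢full (begin
       m φ                          ≡⟨ mask-encode φ ⟩
       + encode (truth φ)           ≡⟨ cong +_ (encode-cong λ w → dec-true (sat? φ w) (sat w)) ⟩
       + encode {n} (λ _ → true)    ≡⟨ full-encode n ⟨
       full n                       ∎))
    (λ (w , ¬sat) m≡full → contradiction
       (trans (sym (encode-injective (+-injective
          (trans (sym (mask-encode φ)) (trans m≡full (full-encode n)))) w))
          (dec-false (sat? φ w) ¬sat))
       λ ())
    where
    open ≡-Reasoning

-- Invariance under isomorphism

varBound : Formula → ℕ
varBound ⊤′       = 0
varBound ⊥′       = 0
varBound (var i)  = suc i
varBound (¬′ φ)   = varBound φ
varBound (φ ∧′ ψ) = varBound φ ⊔ varBound ψ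
varBound (φ ∨′ ψ) = varBound φ ⊔ varBound ψ
varBound (φ ⇒′ ψ) = varBound φ ⊔ varBound ψ
varBound (□ φ)    = varBound φ
varBound (◇ φ)    = varBound φ

module _ (F G : Frame)
  (f : Frame.W F → Frame.W G) (g : Frame.W G → Frame.W F) (f∘g : ∀ x → f (g x) ≡ x)
  (f-embeds : ∀ u v → Frame.R G (f u) (f v) ≡ Frame.R F u v)
  where

  open Frame using (W; R)

  -- `f` is a bounded morphism: the forth condition is the embedding, and a successor `y` of `f w`
  -- lifts to the successor `g y` of `w`. Asking for agreement only below `varBound φ` lets the same
  -- lemma serve for renumbering worlds and for truncating valuations.
  Sat-transport : {V : Valuation (W F)} {V′ : Valuation (W G)} → ∀ φ →
                  (∀ i → i < varBound φ → ∀ w → V′ i (f w) ≡ V i w) →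
                  ∀ w → Sat F V w φ ⇔ Sat G V′ (f w) φ
  Sat-transport ⊤′ eq w = ⇔-id _
  Sat-transport ⊥′ eq w = ⇔-id _
  Sat-transport (var i) eq w = mk⇔ (trans (eq i ≤-refl w)) (trans (sym (eq i ≤-refl w)))
  Sat-transport (¬′ φ) eq w = ¬-cong-⇔ (Sat-transport φ eq w)
  Sat-transport (φ ∧′ ψ) eq w =
    Sat-transport φ (λ i → eq i ∘ m<n⇒m<n⊔o _) w ×-⇔
    Sat-transport ψ (λ i → eq i ∘ m<n⇒m<o⊔n (varBound φ)) w
  Sat-transport (φ ∨′ ψ) eq w =
    Sat-transport φ (λ i → eq i ∘ m<n⇒m<n⊔o _) w ⊎-⇔
    Sat-transport ψ (λ i → eq i ∘ m<n⇒m<o⊔n (varBound φ)) w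
  Sat-transport (φ ⇒′ ψ) eq w = →-cong-⇔
    (Sat-transport φ (λ i → eq i ∘ m<n⇒m<n⊔o _) w)
    (Sat-transport ψ (λ i → eq i ∘ m<n⇒m<o⊔n (varBound φ)) w)
  Sat-transport {V′ = V′} (□ φ) eq w = mk⇔
    (λ sat y fw⟶y → subst (λ x → Sat G V′ x φ) (f∘g y)
       (Equivalence.to (Sat-transport φ eq (g y)) (sat (g y)
          (trans (sym (f-embeds w (g y))) (trans (cong (R G (f w)) (f∘g y)) fw⟶y)))))
    (λ sat v w⟶v → Equivalence.from (Sat-transport φ eq v)
       (sat (f v) (trans (f-embeds w v) w⟶v)))
  Sat-transport {V′ = V′} (◇ φ) eq w = mk⇔
    (λ (v , w⟶v , sat) →
       f v , trans (f-embeds w v) w⟶v , Equivalence.to (Sat-transport φ eq v) sat)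
    (λ (y , fw⟶y , sat) →
       g y
       , trans (sym (f-embeds w (g y))) (trans (cong (R G (f w)) (f∘g y)) fw⟶y)
       , Equivalence.from (Sat-transport φ eq (g y))
           (subst (λ x → Sat G V′ x φ) (sym (f∘g y)) sat))

  private
    pull : ∀ {x y} → R G x y ≡ true → R F (g x) (g y) ≡ true
    pull {x} {y} x⟶y =
      trans (sym (f-embeds (g x) (g y))) (trans (cong₂ (R G) (f∘g x) (f∘g y)) x⟶y)

    push : ∀ {x y} → R F (g x) (g y) ≡ true → R G x y ≡ true
    push {x} {y} gx⟶gy =
      trans (sym (cong₂ (R G) (f∘g x) (f∘g y))) (trans (f-embeds (g x) (g y)) gx⟶gy)

  -- Each class is cut out by implications between edges: premises are pulled back along `g`, and
  -- the conclusion is pushed forward again.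
  ∈ᶜ-transport : ∀ 𝓒 → F ∈ᶜ 𝓒 → G ∈ᶜ 𝓒
  ∈ᶜ-transport K  _  = tt
  ∈ᶜ-transport T  rf = push rf
  ∈ᶜ-transport S4 pre = record
    { isEquivalence = isEquivalence
    ; reflexive     = λ { refl → push (IsPreorder.refl pre) }
    ; trans         = λ x⟶y y⟶z → push (IsPreorder.trans pre (pull x⟶y) (pull y⟶z))
    }
  ∈ᶜ-transport S5 eqv = record
    { refl  = push (IsEquivalence.refl eqv)
    ; sym   = push ∘ IsEquivalence.sym eqv ∘ pull
    ; trans = λ x⟶y y⟶z → push (IsEquivalence.trans eqv (pull x⟶y) (pull y⟶z))
    }

-- Decidability

module _ {n} (R : Fin n → Fin n → Bool) where
  open Frame (onFin R) using (_⟶_)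

  reflexive? : Dec (Reflexive _⟶_)
  reflexive? = map′ (λ h {x} → h x) (λ h x → h {x}) (all? λ x → R x x ≟true)

  symmetric? : Dec (Symmetric _⟶_)
  symmetric? = map′ (λ h {x} {y} → h x y) (λ h x y → h {x} {y})
    (all? λ x → all? λ y → R x y ≟true →-dec R y x ≟true)

  transitive? : Dec (Transitive _⟶_)
  transitive? = map′ (λ h {x} {y} {z} → h x y z) (λ h x y z → h {x} {y} {z})
    (all? λ x → all? λ y → all? λ z → R x y ≟true →-dec (R y z ≟true →-dec R x z ≟true))

  reflexive×transitive⇔isPreorder :
    (Reflexive _⟶_ × Transitive _⟶_) ⇔ IsPreorder _≡_ _⟶_
  reflexive×transitive⇔isPreorder = mk⇔ ⇒ ⇐
    where
    ⇒ : Reflexive _⟶_ × Transitive _⟶_ → IsPreorder _≡_ _⟶_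
    ⇒ (rf , tr) = record
      { isEquivalence = isEquivalence ; reflexive = λ { refl → rf } ; trans = tr }
    ⇐ : IsPreorder _≡_ _⟶_ → Reflexive _⟶_ × Transitive _⟶_
    ⇐ pre = IsPreorder.refl pre , IsPreorder.trans pre

  reflexive×symmetric×transitive⇔isEquivalence :
    (Reflexive _⟶_ × Symmetric _⟶_ × Transitive _⟶_) ⇔ IsEquivalence _⟶_
  reflexive×symmetric×transitive⇔isEquivalence = mk⇔ ⇒ ⇐
    where
    ⇒ : Reflexive _⟶_ × Symmetric _⟶_ × Transitive _⟶_ → IsEquivalence _⟶_
    ⇒ (rf , sy , tr) = record { refl = rf ; sym = sy ; trans = tr }
    ⇐ : IsEquivalence _⟶_ → Reflexive _⟶_ × Symmetric _⟶_ × Transitive _⟶_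
    ⇐ eqv = IsEquivalence.refl eqv , IsEquivalence.sym eqv , IsEquivalence.trans eqv

  _∈ᶜ?_ : ∀ 𝓒 → Dec (onFin R ∈ᶜ 𝓒)
  _∈ᶜ?_ K  = yes tt
  _∈ᶜ?_ T  = reflexive?
  _∈ᶜ?_ S4 = map reflexive×transitive⇔isPreorder (reflexive? ×-dec transitive?)
  _∈ᶜ?_ S5 = map reflexive×symmetric×transitive⇔isEquivalence
    (reflexive? ×-dec symmetric? ×-dec transitive?)

-- The relation _≈_ replaces equality because, without function
-- extensionality, a search over functions only covers them up to pointwise
-- equality.

Exhaustible : (A : Set) → Rel A 0ℓ → Set₁
Exhaustible A _≈_ = ∀ {P : Pred A 0ℓ} → P Respects _≈_ → Decidable P → Dec (∃ P)

Bool-exhaustible : Exhaustible Bool _≡_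
Bool-exhaustible {P} _ P? = map′
  (λ { (inj₁ p) → true , p ; (inj₂ p) → false , p })
  (λ { (true , p) → inj₁ p ; (false , p) → inj₂ p })
  (P? true ⊎-dec P? false)

Pointwise : ∀ {A : Set} {n} → Rel A 0ℓ → Rel (Vector A n) 0ℓ
Pointwise _≈_ xs ys = ∀ i → xs i ≈ ys i

-- The search for a head contains a search for a tail. A vector agrees with the one rebuilt from its
-- head and tail only pointwise, so `P` has to respect `_≈_`.
Vector-exhaustible : ∀ {A : Set} {_≈_ : Rel A 0ℓ} → Reflexive _≈_ →
                     Exhaustible A _≈_ → ∀ n → Exhaustible (Vector A n) (Pointwise _≈_)
Vector-exhaustible ≈-refl search zero {P} resp P? = map′
  ([] ,_) (λ (xs , p) → resp {xs} {[]} (λ ()) p) (P? [])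
Vector-exhaustible {_≈_ = _≈_} ≈-refl search (suc n) {P} resp P? = map′
  (λ (x , xs , p) → x ∷ xs , p)
  (λ (xs , p) → head xs , tail xs , resp (λ { zero → ≈-refl ; (suc i) → ≈-refl }) p)
  (search head-resp λ x →
     Vector-exhaustible {_≈_ = _≈_} ≈-refl search n (tail-resp x) (λ xs → P? (x ∷ xs)))
  where
  head-resp : (λ x → ∃[ xs ] P (x ∷ xs)) Respects _≈_
  head-resp x≈y (xs , p) = xs , resp (λ { zero → x≈y ; (suc i) → ≈-refl }) p
  tail-resp : ∀ x → (λ xs → P (x ∷ xs)) Respects Pointwise _≈_
  tail-resp x xs≈ys = resp (λ { zero → ≈-refl ; (suc i) → xs≈ys i })

BoolMatrix-exhaustible : ∀ m n → Exhaustible (Vector (Vector Bool n) m) (Pointwise (Pointwise _≡_))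
BoolMatrix-exhaustible m n =
  Vector-exhaustible (λ _ → refl) (Vector-exhaustible refl Bool-exhaustible n) m

-- The default `false` concerns variables from `d` on; with `d` equal to `varBound φ` it cannot
-- affect φ.
extend : ∀ {W : Set} {d} → Vector (W → Bool) d → Valuation W
extend {d = zero}  U i       w = false
extend {d = suc d} U zero    w = U zero w
extend {d = suc d} U (suc i) w = extend (U ∘ suc) i w

extend-cong : ∀ {W : Set} {d} {U U′ : Vector (W → Bool) d} →
              (∀ j w → U j w ≡ U′ j w) → ∀ i w → extend U i w ≡ extend U′ i w
extend-cong {d = zero}  eq i       w = refl
extend-cong {d = suc d} eq zero    w = eq zero w
extend-cong {d = suc d} eq (suc i) w = extend-cong (eq ∘ suc) i w

extend-restrict : ∀ {W : Set} {d} (V : Valuation W) i → i < d → ∀ w →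
                  extend {d = d} (λ j → V (toℕ j)) i w ≡ V i w
extend-restrict {d = suc d} V zero    _         w = refl
extend-restrict {d = suc d} V (suc i) (s≤s i<d) w = extend-restrict (V ∘ suc) i i<d w

Refutes : ∀ {n} → (Fin n → Fin n → Bool) → Valuation (Fin n) → Formula → Set
Refutes R V φ = ∃[ w ] ¬ Sat (onFin R) V w φ

Refutes-cong : ∀ {n} {R R′ : Fin n → Fin n → Bool} {V V′ : Valuation (Fin n)} φ →
               (∀ u v → R u v ≡ R′ u v) →
               (∀ i → i < varBound φ → ∀ w → V i w ≡ V′ i w) →
               Refutes R V φ → Refutes R′ V′ φ
Refutes-cong {R = R} {R′} φ R≈R′ V≈V′ (w , ¬sat) = w , ¬sat ∘ Equivalence.from
  (Sat-transport (onFin R) (onFin R′) id id (λ _ → refl) (λ u v → sym (R≈R′ u v))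
    φ (λ i i<d w → sym (V≈V′ i i<d w)) w)

-- The middle term between scan and countermodels. Unlike `FindsCountermodelOfSize`, which involves
-- an arbitrary predicate `Examined`, it is decidable at every size.
Refutable : FrameClass → Formula → ℕ → Set
Refutable 𝓒 φ n =
  Σ[ R ∈ (Fin n → Fin n → Bool) ] (onFin R ∈ᶜ 𝓒) × (∃[ V ] Refutes R V φ)

refutable? : ∀ 𝓒 φ → Decidable (Refutable 𝓒 φ)
refutable? 𝓒 φ n = BoolMatrix-exhaustible n n
  (λ {R} {R′} R≈R′ (R∈𝓒 , V , ref) →
     ∈ᶜ-transport (onFin R) (onFin R′) id id (λ _ → refl) (λ u v → sym (R≈R′ u v)) 𝓒 R∈𝓒
     , V , Refutes-cong φ R≈R′ (λ _ _ _ → refl) ref)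
  (λ R → (R ∈ᶜ? 𝓒) ×-dec valuation? R)
  where
  valuation? : ∀ R → Dec (∃[ V ] Refutes R V φ)
  valuation? R = map′
    (λ (U , ref) → extend U , ref)
    -- Any refuting valuation can be cut down to the variables below `varBound φ`, a finite Boolean
    -- table.
    (λ (V , ref) → (λ j → V (toℕ j)) ,
       Refutes-cong φ (λ _ _ → refl) (λ i i<d w → sym (extend-restrict V i i<d w)) ref)
    (BoolMatrix-exhaustible (varBound φ) n
      (λ U≈U′ → Refutes-cong φ (λ _ _ → refl) (λ i _ → extend-cong U≈U′ i))
      (λ U → any? (λ w → ¬? (sat? R (extend U) φ w))))

-- Descent from a known element: a bounded search either finds a smaller one or certifies that there
-- is none.
least : {P : Pred ℕ 0ℓ} → Decidable P → ∃ P → ∃ (IsLeast P)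
least {P} P? (m , p) = go m p (<-wellFounded m)
  where
  go : ∀ n → P n → Acc _<_ n → ∃ (IsLeast P)
  go n p (acc rs) with anyUpTo? P? n
  ... | yes (k , k<n , q) = go k q (rs k<n)
  ... | no  none          = n , p , λ k q → ≮⇒≥ (λ k<n → none (k , k<n , q))

-- Renumbering the worlds of a finite frame

module _ (F : Frame) where
  open Frame F using (W; R; enum) renaming (size to n)
  open Inverse enum

  numbered : Fin n → Fin n → Bool
  numbered x y = R (from x) (from y)

  private
    numbered-embeds : ∀ u v → numbered (to u) (to v) ≡ R u v
    numbered-embeds u v = cong₂ R (strictlyInverseʳ u) (strictlyInverseʳ v)

  numbered-∈ᶜ : ∀ 𝓒 → F ∈ᶜ 𝓒 → onFin numbered ∈ᶜ 𝓒
  numbered-∈ᶜ = ∈ᶜ-transport F (onFin numbered) to from strictlyInverseˡ numbered-embeds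

  numbered-Sat : ∀ V w φ → Sat F V w φ ⇔ Sat (onFin numbered) (λ i → V i ∘ from) (to w) φ
  numbered-Sat V w φ = Sat-transport F (onFin numbered) to from strictlyInverseˡ numbered-embeds
    φ (λ i _ v → cong (V i) (strictlyInverseʳ v)) w

  frameSat? : ∀ V w φ → Dec (Sat F V w φ)
  frameSat? V w φ = map′ (Equivalence.from eq) (Equivalence.to eq) (sat? numbered _ φ (to w))
    where eq = numbered-Sat V w φ

countermodel⇒refutable : ∀ {𝓒 φ} (M : Countermodel 𝓒 φ) → Refutable 𝓒 φ (Countermodel.size M)
countermodel⇒refutable {𝓒} {φ} M =
  numbered frame , numbered-∈ᶜ frame 𝓒 inClass , _ , _ ,
  refutes ∘ Equivalence.from (numbered-Sat frame valuation world φ)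
  where open Countermodel M

refutable⇒countermodel : ∀ {𝓒 φ n} → Refutable 𝓒 φ n →
                         Σ[ M ∈ Countermodel 𝓒 φ ] Countermodel.size M ≡ n
refutable⇒countermodel (R , R∈𝓒 , V , w , ¬sat) = record
  { frame = onFin R ; inClass = R∈𝓒 ; valuation = V ; world = w ; refutes = ¬sat } , refl

refutable⇒certificate : ∀ {𝓒 φ n} → Refutable 𝓒 φ n →
                        Σ[ c ∈ Certificate ] ValidCertificate c
                          × Certificate.formula c ≡ φ
                          × Certificate.n c ≡ n
                          × Certificate.class c ≡ 𝓒
refutable⇒certificate {𝓒} {φ} {n} (R , R∈𝓒 , V , w , ¬sat) = record
  { formula = φ ; n = n ; succ = succMask R ; valuation = V ; world = w ; class = 𝓒 }
  , (R , (λ _ → refl) , R∈𝓒 , ¬sat) , refl , refl , refl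

-- Soundness and completeness of the scan

module _ {𝓒 : FrameClass} {φ : Formula} {N : ℕ} (S : Scan 𝓒)
         (exhaustive : Scan.ExaminesAllUpTo S N) where

  open Scan S

  finds⇒refutable : ∀ {n} → FindsCountermodelOfSize φ n → Refutable 𝓒 φ n
  finds⇒refutable (R , V , examined , m≢full) =
    R , inClass examined , V , Equivalence.to (mask≢full⇔ R V φ) m≢full

  refutable⇒finds : ∀ {n} → n ≤ N → Refutable 𝓒 φ n → FindsCountermodelOfSize φ n
  refutable⇒finds n≤N (R , R∈𝓒 , V , ref) =
    R , V , exhaustive n≤N R R∈𝓒 V , Equivalence.from (mask≢full⇔ R V φ) ref

theorem2 : (𝓒 : FrameClass) (φ : Formula) (N : ℕ) (S : Scan 𝓒) →
    Scan.ExaminesAllUpTo S N →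
    ( (b : Formula → ℕ) → IsFMPBound 𝓒 b →
    ¬ (∃[ n ] n ≤ N × Scan.FindsCountermodelOfSize S φ n) →
    b φ ≤ N →
    ValidOn 𝓒 φ )
    ×
    ( (∃[ n ] n ≤ N × Scan.FindsCountermodelOfSize S φ n) →
    ∃[ n ] IsLeast (λ k → k ≤ N × Scan.FindsCountermodelOfSize S φ k) n
    × IsMinimalCountermodelSize 𝓒 φ n
    × (Σ[ c ∈ Certificate ] ValidCertificate c
    × Certificate.formula c ≡ φ
    × Certificate.n c ≡ n
    × Certificate.class c ≡ 𝓒) )
theorem2 𝓒 φ N S exhaustive = validity , minimality
  where
  finds = refutable⇒finds {φ = φ} S exhaustive

  validity : (b : Formula → ℕ) → IsFMPBound 𝓒 b →
             ¬ (∃[ n ] n ≤ N × Scan.FindsCountermodelOfSize S φ n) → b φ ≤ N → ValidOn 𝓒 φ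
  -- The bound returns a countermodel, possibly on a frame other than `F`, only from non-validity.
  -- So failure at `w` is assumed, and decidability on `F` removes the double negation.
  validity b fmp none bφ≤N F F∈𝓒 V w = decidable-stable (frameSat? F V w φ) λ ¬sat →
    let M , size≤bφ = fmp φ (λ valid → ¬sat (valid F F∈𝓒 V w))
        size≤N      = ≤-trans size≤bφ bφ≤N
    in none (_ , size≤N , finds size≤N (countermodel⇒refutable M))

  minimality : (∃[ n ] n ≤ N × Scan.FindsCountermodelOfSize S φ n) → _
  minimality (k , k≤N , found)
    -- Minimising over all refutable sizes, not only scanned ones, makes the result a lower bound
    -- for every countermodel.
    with least (refutable? 𝓒 φ) (k , finds⇒refutable S exhaustive found)
  ... | n , ref , minimal =
    n
    , ((n≤N , finds n≤N ref) , λ j (_ , f) → minimal j (finds⇒refutable S exhaustive f))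
    , (refutable⇒countermodel ref , λ M → minimal _ (countermodel⇒refutable M))
    , refutable⇒certificate ref
    where
    -- The minimum is at most the size `k` already found, so it lies in the range where the scan is
    -- exhaustive and is itself found.
    n≤N : n ≤ N
    n≤N = ≤-trans (minimal k (finds⇒refutable S exhaustive found)) k≤N
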